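{- Let $n,m$ be integers with $6 \le n \le m \le 2n-1$. If $n+m \equiv 0 \pmod 3$ or $n+m \equiv 2 \pmod 3$, then \[\gamma^{\rm ID}(K_n\times K_m) = \left\lfloor \frac{2m+2n}{3}\right\rfloor.\]
   Context: For a graph $G$ and vertex $x$, $N[x]$ denotes the closed neighborhood of $x$. A set $C \subseteq V(G)$ is an identifying code (ID code) of $G$ if $C$ is a dominating set of $G$ and $N[x]\cap C \ne N[y]\cap C$ for every pair of distinct vertices $x,y$. $\gamma^{\rm ID}(G)$ is the minimum cardinality of an ID code of $G$. The direct product $G_1\times G_2$ has vertex set $V(G_1)\times V(G_2)$, with $(u_1,u_2)$ adjacent to $(v_1,v_2)$ iff $u_1v_1\in E(G_1)$ and $u_2v_2 \in E(G_2)$. $K_n$ is the complete graph on vertex set $[n]=\{1,\dots,n\}$; thus in $K_n\times K_m$ two vertices are adjacent iff they differ in both coordinates. -}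

module Defs where

open import Data.Fin.Base using (Fin)
open import Data.List.Base using (List; length)
open import Data.List.Membership.Propositional using (_∈_)
open import Data.List.Relation.Unary.Unique.Propositional using (Unique)
open import Data.Nat.Base using (ℕ; _≤_)
open import Data.Product.Base using (_×_; _,_; ∃-syntax)
open import Data.Sum.Base using (_⊎_)
open import Level using (0ℓ)
open import Relation.Binary.Core using (Rel)
open import Relation.Binary.Definitions using (Symmetric; Irreflexive)
open import Relation.Binary.PropositionalEquality using (_≡_; _≢_; refl; ≢-sym)
open import Relation.Nullary.Negation using (¬_)
open import Relation.Unary using (Pred; _∩_; _≐_)

record Graph : Set₁ where
  field
    Vertex     : Set
    Adj        : Rel Vertex 0ℓ
    Adj-sym    : Symmetric Adj
    Adj-irrefl : Irreflexive _≡_ Adj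

open Graph

N[_] : {G : Graph} → Vertex G → Pred (Vertex G) 0ℓ
N[_] {G} x y = y ≡ x ⊎ Adj G x y

-- Sets of vertices are given by listing their elements; repetitions only
-- matter for the cardinality, and are excluded in IsγID.

IsDominating : (G : Graph) → List (Vertex G) → Set
IsDominating G C = ∀ (x : Vertex G) → ∃[ c ] c ∈ C × N[_] {G} c x

IsIDCode : (G : Graph) → List (Vertex G) → Set
IsIDCode G C =
  IsDominating G C ×
  (∀ (x y : Vertex G) → x ≢ y →
     ¬ ((N[_] {G} x ∩ (_∈ C)) ≐ (N[_] {G} y ∩ (_∈ C))))

-- IsγID G k states that γᴵᴰ(G) exists and equals k. It is a relation because
-- a graph with two vertices of equal closed neighborhoods has no ID code.
IsγID : Graph → ℕ → Set
IsγID G k =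
  (∃[ C ] Unique C × IsIDCode G C × length C ≡ k) ×
  (∀ (C : List (Vertex G)) → Unique C → IsIDCode G C → k ≤ length C)

K : ℕ → Graph
K n = record
  { Vertex     = Fin n
  ; Adj        = _≢_
  ; Adj-sym    = ≢-sym
  ; Adj-irrefl = λ x≡y x≢y → x≢y x≡y
  }

infixr 7 _×ᴳ_

_×ᴳ_ : Graph → Graph → Graph
G ×ᴳ H = record
  { Vertex     = Vertex G × Vertex H
  ; Adj        = λ (u₁ , u₂) (v₁ , v₂) → Adj G u₁ v₁ × Adj H u₂ v₂
  ; Adj-sym    = λ (a , b) → Adj-sym G a , Adj-sym H b
  ; Adj-irrefl = λ where refl (a , _) → Adj-irrefl G refl a
  }

{-# OPTIONS --safe #-}

-- View a set of vertices of Kₙ × Kₘ as the edge set E of a bipartite graph between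
-- n rows and m columns, and put N = n + m. The code vertices outside the closed
-- neighbourhood of (i , j) are the edges that meet exactly one of i and j.
--
-- Lower bound. At most one row and at most one column is isolated in E, there is at
-- most one isolated edge, and none if both an isolated row and an isolated column
-- exist; an isolated row also forbids components P₃ centred in rows, and dually.
-- If every edge distributes 3 units so that each leaf receives 2, then every vertex
-- of positive degree receives 2, except that one end of an isolated edge receives
-- only 1. This gives 3 |E| + 2 ≥ 2 N, unless there are an isolated row and an
-- isolated column (then no component is a P₃ and 4 |E| ≥ 3 (N − 2) suffices), or an
-- isolated line and an isolated edge (then equality forces m = 2 n or n = 2 m).
--
-- Upper bound. Take for E a disjoint union of paths P₃, together with one isolated
-- edge when n + m ≡ 2 (mod 3).
module Submission where

open import Defs
open import Data.Nat using (ℕ; _+_; _*_; _∸_; _≤_; _/_; _%_)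
open import Data.Sum using (_⊎_)
open import Relation.Binary.PropositionalEquality using (_≡_)

open import Algebra.Properties.Semiring.Sum using ()
open import Data.Bool.Base using (Bool; true; false; _∨_)
open import Data.Bool.Properties as Bool using ()
open import Data.Empty using (⊥-elim)
open import Data.Fin.Base using (Fin; zero; suc; punchIn; punchOut; opposite)
open import Data.Fin.Properties as Fin using (any?; punchInᵢ≢i; punchIn-punchOut; punchOut-injective; +↔⊎; *↔×)
open import Data.List.Base using (List; []; _∷_; length; tabulate)
open import Data.List.Membership.Propositional using (_∈_)
open import Data.List.Membership.Propositional.Properties using (∈-tabulate⁺)
open import Data.List.Properties using (length-tabulate)
open import Data.List.Relation.Unary.Unique.Propositional using (Unique)
open import Data.List.Relation.Unary.Unique.Propositional.Properties using (tabulate⁺)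
open import Data.Nat using (zero; suc; _<_; z≤n; s≤s; _≤?_; s≤s⁻¹; >-nonZero)
open import Data.Nat.DivMod
open import Data.Nat.Divisibility using (divides-refl)
open import Data.Nat.Properties
open import Data.Nat.Tactic.RingSolver using (solve-∀)
open import Data.Product.Base using (_×_; _,_; proj₁; proj₂; ∃-syntax; swap)
open import Data.Product.Properties using (≡-dec)
open import Data.Sum as Sum using (inj₁; inj₂)
open import Data.Sum.Function.Propositional using (_⊎-↔_)
open import Data.Sum.Properties using (inj₁-injective; inj₂-injective)
open import Data.Vec.Functional using (removeAt)
open import Function.Base using (flip; _∘_; case_of_)
open import Function.Bundles using (_⇔_; mk⇔; Equivalence; _↔_; Inverse; Injection)
open import Function.Construct.Composition using (_↔-∘_)
open import Function.Construct.Identity using (↔-id)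
open import Function.Properties.Inverse using (↔-sym; ↔⇒↣)
open import Relation.Binary.Definitions using (DecidableEquality)
open import Relation.Binary.PropositionalEquality using (_≢_; refl; sym; trans; cong; cong₂; subst; subst₂; ≢-sym)
open import Relation.Nullary using (¬_; does; yes; no; contradiction; ¬?; _×-dec_; decidable-stable)
open import Relation.Nullary.Decidable using (dec-true; via-injection)
open import Relation.Unary using (_∩_; _≐_)

open Algebra.Properties.Semiring.Sum +-*-semiring
  using (sum; sum-remove; sum-cong-≗; ∑-distrib-+; ∑-comm; *-distribˡ-sum)

-- Finite sums of natural numbers.

sum-mono : ∀ {n} {f g : Fin n → ℕ} → (∀ i → f i ≤ g i) → sum f ≤ sum g
sum-mono {zero}  f≤g = z≤n
sum-mono {suc n} f≤g = +-mono-≤ (f≤g zero) (sum-mono (f≤g ∘ suc))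

sum-mono-< : ∀ {n} {f g : Fin n → ℕ} → (∀ i → f i ≤ g i) →
             ∀ i → f i < g i → sum f < sum g
sum-mono-< f≤g zero    f<g = +-mono-<-≤ f<g (sum-mono (f≤g ∘ suc))
sum-mono-< f≤g (suc i) f<g = +-mono-≤-< (f≤g zero) (sum-mono-< (f≤g ∘ suc) i f<g)

sum-const : ∀ n k → sum {n} (λ _ → k) ≡ n * k
sum-const zero    k = refl
sum-const (suc n) k = cong (k +_) (sum-const n k)

sum≢0⇒∃ : ∀ {n} (f : Fin n → ℕ) → sum f ≢ 0 → ∃[ i ] f i ≢ 0
sum≢0⇒∃ {zero}  f ≢0 = contradiction refl ≢0
sum≢0⇒∃ {suc n} f ≢0 with f zero in eq
... | suc _ = zero , λ f0≡0 → case trans (sym eq) f0≡0 of λ ()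
... | zero  with i , fi≢0 ← sum≢0⇒∃ (f ∘ suc) ≢0 = suc i , fi≢0

lookup≤sum : ∀ {n} (f : Fin n → ℕ) i → f i ≤ sum f
lookup≤sum {suc n} f i = subst (f i ≤_) (sym (sum-remove {i = i} f)) (m≤m+n (f i) _)

pair≤sum : ∀ {n} (f : Fin n → ℕ) {i j} → i ≢ j → f i + f j ≤ sum f
pair≤sum {suc n} f {i} {j} i≢j = subst (f i + f j ≤_) (sym (sum-remove {i = i} f))
  (+-monoʳ-≤ (f i) (subst (λ k → f k ≤ sum (removeAt f i)) (punchIn-punchOut i≢j)
    (lookup≤sum (removeAt f i) (punchOut i≢j))))

triple≤sum : ∀ {n} (f : Fin n → ℕ) {i j k} → i ≢ j → i ≢ k → j ≢ k →
             f i + (f j + f k) ≤ sum f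
triple≤sum {suc n} f {i} {j} {k} i≢j i≢k j≢k =
  subst (f i + (f j + f k) ≤_) (sym (sum-remove {i = i} f))
    (+-monoʳ-≤ (f i) (subst (_≤ sum (removeAt f i))
      (cong₂ (λ a b → f a + f b) (punchIn-punchOut i≢j) (punchIn-punchOut i≢k))
      (pair≤sum (removeAt f i) (j≢k ∘ punchOut-injective i≢j i≢k))))

sum≤1 : ∀ {n} (f : Fin n → ℕ) → (∀ i → f i ≤ 1) →
        (∀ i j → f i ≢ 0 → f j ≢ 0 → i ≡ j) → sum f ≤ 1
sum≤1 {zero}  f f≤1 unique = z≤n
sum≤1 {suc n} f f≤1 unique with f zero in eq
... | zero  = sum≤1 (f ∘ suc) (f≤1 ∘ suc) λ i j p q → Fin.suc-injective (unique (suc i) (suc j) p q)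
... | suc k = +-mono-≤ (subst (_≤ 1) eq (f≤1 zero)) (≤-reflexive rest≡0)
  where
  rest≡0 : sum (f ∘ suc) ≡ 0
  rest≡0 with sum (f ∘ suc) ≟ 0
  ... | yes ≡0 = ≡0
  ... | no  ≢0 with i , fi≢0 ← sum≢0⇒∃ (f ∘ suc) ≢0 =
    case unique zero (suc i) (λ f0≡0 → case trans (sym eq) f0≡0 of λ ()) fi≢0 of λ ()

sum-sum≤1 : ∀ {n m} (f : Fin n → Fin m → ℕ) → (∀ i j → f i j ≤ 1) →
            (∀ {i j i′ j′} → f i j ≢ 0 → f i′ j′ ≢ 0 → i ≡ i′ × j ≡ j′) → sum (sum ∘ f) ≤ 1
sum-sum≤1 f f≤1 unique = sum≤1 (sum ∘ f)
  (λ i → sum≤1 (f i) (f≤1 i) λ j k p q → proj₂ (unique p q))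
  λ i i′ p q → let _ , r = sum≢0⇒∃ (f i) p
                   _ , s = sum≢0⇒∃ (f i′) q
               in proj₁ (unique r s)

-- Vertex sets as bipartite graphs, and degrees.

𝟙 : Bool → ℕ
𝟙 true  = 1
𝟙 false = 0

𝟙≤1 : ∀ b → 𝟙 b ≤ 1
𝟙≤1 true  = ≤-refl
𝟙≤1 false = z≤n

𝟙≢0 : ∀ {b} → 𝟙 b ≢ 0 → b ≡ true
𝟙≢0 {true}  _  = refl
𝟙≢0 {false} ≢0 = contradiction refl ≢0

-- A set of vertices of Kₙ × Kₘ is viewed as the edge set of a bipartite graph
-- between the n rows and the m columns; `flip` exchanges the two sides.
Edges : ℕ → ℕ → Set
Edges n m = Fin n → Fin m → Bool

deg : ∀ {n m} → Edges n m → Fin n → ℕ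
deg E i = sum λ j → 𝟙 (E i j)

size : ∀ {n m} → Edges n m → ℕ
size E = sum (deg E)

size-flip : ∀ {n m} (E : Edges n m) → size (flip E) ≡ size E
size-flip E = ∑-comm λ j i → 𝟙 (E i j)

module _ {n m : ℕ} (E : Edges n m) where

  edge⇒deg≢0 : ∀ {i j} → E i j ≡ true → deg E i ≢ 0
  edge⇒deg≢0 {i} {j} e d≡0 = n≮0 (subst (1 ≤_) d≡0
    (subst (λ b → 𝟙 b ≤ deg E i) e (lookup≤sum (λ j → 𝟙 (E i j)) j)))

  leaf-unique : ∀ {i j k} → deg E i ≡ 1 → E i j ≡ true → E i k ≡ true → j ≡ k
  leaf-unique {i} {j} {k} d≡1 e e′ with j Fin.≟ k
  ... | yes j≡k = j≡k
  ... | no  j≢k = contradiction (pair≤sum (λ j → 𝟙 (E i j)) j≢k) (<⇒≱ (≤-reflexive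
    (trans (cong suc d≡1) (sym (cong₂ (λ a b → 𝟙 a + 𝟙 b) e e′)))))

  record Neighbours₂ (i : Fin n) : Set where
    field
      {a b} : Fin m
      a≢b   : a ≢ b
      Ea    : E i a ≡ true
      Eb    : E i b ≡ true
      only  : ∀ {j} → E i j ≡ true → j ≡ a ⊎ j ≡ b

neighbours₂ : ∀ {n m} (E : Edges n m) {i} → deg E i ≡ 2 → Neighbours₂ E i
neighbours₂ {m = zero}  E ()
neighbours₂ {m = suc m} E {i} d≡2
  with a , a≢0 ← sum≢0⇒∃ (λ j → 𝟙 (E i j)) (λ d≡0 → case trans (sym d≡2) d≡0 of λ ())
  with b′ , b≢0 ← sum≢0⇒∃ (removeAt (λ j → 𝟙 (E i j)) a) (λ r≡0 →
         case trans (sym d≡2) (trans (sum-remove {i = a} (λ j → 𝟙 (E i j))) (cong₂ (λ x y → 𝟙 x + y) (𝟙≢0 a≢0) r≡0)) of λ ())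
  = record { a≢b = ≢-sym (punchInᵢ≢i a b′) ; Ea = Ea ; Eb = Eb ; only = only }
  where
  b = punchIn a b′
  Ea : E i a ≡ true
  Ea = 𝟙≢0 a≢0
  Eb : E i b ≡ true
  Eb = 𝟙≢0 b≢0
  only : ∀ {j} → E i j ≡ true → j ≡ a ⊎ j ≡ b
  only {j} Ej with j Fin.≟ a | j Fin.≟ b
  ... | yes j≡a | _       = inj₁ j≡a
  ... | no  _   | yes j≡b = inj₂ j≡b
  ... | no  j≢a | no  j≢b = contradiction
    (triple≤sum (λ j → 𝟙 (E i j)) j≢a j≢b (≢-sym (punchInᵢ≢i a b′)))
    (<⇒≱ (≤-reflexive (trans (cong suc d≡2)
      (sym (cong₂ _+_ (cong 𝟙 Ej) (cong₂ (λ x y → 𝟙 x + 𝟙 y) Ea Eb))))))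

-- (a , b) lies in the closed neighbourhood of (i , j).
Agree : ∀ {n m} → Fin n → Fin m → Fin n → Fin m → Set
Agree i j a b = (a ≡ i → b ≡ j) × (b ≡ j → a ≡ i)

-- Identification in contrapositive form, so that every application yields equalities of
-- coordinates.
Separating : ∀ {n m} → Edges n m → Set
Separating E = ∀ {i j i′ j′} →
  (∀ {a b} → E a b ≡ true → Agree i j a b ⇔ Agree i′ j′ a b) → i ≡ i′ × j ≡ j′

Separating-flip : ∀ {n m} (E : Edges n m) → Separating E → Separating (flip E)
Separating-flip E sep h = swap (sep λ e → mk⇔ (swap ∘ Equivalence.to (h e) ∘ swap) (swap ∘ Equivalence.from (h e) ∘ swap))

HasNonleafNeighbour : ∀ {n m} → Edges n m → Fin n → Set
HasNonleafNeighbour E i = ∃[ j ] E i j ≡ true × deg (flip E) j ≢ 1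

module _ {n m : ℕ} (E : Edges n m) (sep : Separating E) where

  -- Pair both rows with one common column, here `zero`: since no edge lies in either row, agreeing
  -- with either vertex just means avoiding that column.
  empty-unique : 0 < m → ∀ {i i′} → deg E i ≡ 0 → deg E i′ ≡ 0 → i ≡ i′
  empty-unique (s≤s _) {i} {i′} d≡0 d′≡0 = proj₁ (sep {j = zero} {j′ = zero} λ e →
    mk⇔ (λ (_ , b≢) → (λ { refl → contradiction d′≡0 (edge⇒deg≢0 E e) }) ,
                       λ { refl → case b≢ refl of λ { refl → contradiction d≡0 (edge⇒deg≢0 E e) } })
        (λ (_ , b≢) → (λ { refl → contradiction d≡0 (edge⇒deg≢0 E e) }) ,
                       λ { refl → case b≢ refl of λ { refl → contradiction d′≡0 (edge⇒deg≢0 E e) } }))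

  -- A vertex whose closed neighbourhood contains the whole code is unique. Both an isolated edge
  -- and the crossing of an empty row with an empty column are of this kind.
  isolated-unique : ∀ {i j i′ j′} →
    (∀ {a b} → E a b ≡ true → Agree i j a b) →
    (∀ {a b} → E a b ≡ true → Agree i′ j′ a b) → i ≡ i′ × j ≡ j′
  isolated-unique h h′ = sep λ e → mk⇔ (λ _ → h′ e) (λ _ → h e)

  -- If the row i were the centre of a component P₃ with leaves a and b, then
  -- (i₀ , a) and (i , b) would have the same code neighbours.
  empty⇒nonleaf-neighbour : ∀ {i₀ i} → deg E i₀ ≡ 0 → deg E i ≡ 2 → HasNonleafNeighbour E i
  empty⇒nonleaf-neighbour {i₀} {i} d₀≡0 d≡2
    with any? (λ j → (E i j Bool.≟ true) ×-dec ¬? (deg (flip E) j ≟ 1))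
  ... | yes found = found
  ... | no  none  = case trans (sym d≡2) (subst (λ i → deg E i ≡ 0) i₀≡i d₀≡0) of λ ()
    where
    open Neighbours₂ (neighbours₂ E d≡2)
    leaf : ∀ {u v} → E i v ≡ true → E u v ≡ true → u ≡ i
    leaf {v = v} e e′ = leaf-unique (flip E)
      (decidable-stable (deg (flip E) v ≟ 1) λ d≢1 → none (v , e , d≢1)) e′ e
    i₀≡i : i₀ ≡ i
    -- For an edge `(u , v)` both sides amount to `v ≢ a`, because `(i , a)` is the only edge in
    -- column `a` and `(i , b)` the only other edge in row `i`.
    i₀≡i = proj₁ (sep {i₀} {a} {i} {b} λ {u} {v} e → mk⇔
      (λ (_ , v≡a⇒) →
        (λ { refl → case only e of λ where
              (inj₁ v≡a) → case v≡a⇒ v≡a of λ { refl → contradiction d₀≡0 (edge⇒deg≢0 E e) }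
              (inj₂ v≡b) → v≡b }) ,
        (λ { refl → leaf Eb e }))
      (λ (u≡i⇒ , _) →
        (λ { refl → contradiction d₀≡0 (edge⇒deg≢0 E e) }) ,
        (λ { refl → contradiction (u≡i⇒ (leaf Ea e)) a≢b })))

-- Discharging.

-- The share that the end of degree d receives from an edge of total weight
-- 2 + 2 β whose other end has degree d′.
share : ℕ → ℕ → ℕ → ℕ
share β 1 _ = 2 + β
share β _ 1 = β
share β _ _ = 1 + β

bothLeaves : ℕ → ℕ → ℕ
bothLeaves 1 1 = 1
bothLeaves _ _ = 0

isZero : ℕ → ℕ
isZero zero    = 1
isZero (suc _) = 0

-- Two leaves take `2 + β` each, so an isolated edge overspends its weight by exactly 2.
share-total : ∀ β d d′ → share β d d′ + share β d′ d ≡ (2 + 2 * β) + 2 * bothLeaves d d′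
share-total β 0 0 = lemma β
  where lemma : ∀ β → (1 + β) + (1 + β) ≡ (2 + 2 * β) + 2 * 0
        lemma = solve-∀
share-total β 0 1 = lemma β
  where lemma : ∀ β → β + (2 + β) ≡ (2 + 2 * β) + 2 * 0
        lemma = solve-∀
share-total β 0 (suc (suc _)) = lemma β
  where lemma : ∀ β → (1 + β) + (1 + β) ≡ (2 + 2 * β) + 2 * 0
        lemma = solve-∀
share-total β 1 0 = lemma β
  where lemma : ∀ β → (2 + β) + β ≡ (2 + 2 * β) + 2 * 0
        lemma = solve-∀
share-total β 1 1 = lemma β
  where lemma : ∀ β → (2 + β) + (2 + β) ≡ (2 + 2 * β) + 2 * 1
        lemma = solve-∀
share-total β 1 (suc (suc _)) = lemma β
  where lemma : ∀ β → (2 + β) + β ≡ (2 + 2 * β) + 2 * 0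
        lemma = solve-∀
share-total β (suc (suc _)) 0 = lemma β
  where lemma : ∀ β → (1 + β) + (1 + β) ≡ (2 + 2 * β) + 2 * 0
        lemma = solve-∀
share-total β (suc (suc _)) 1 = lemma β
  where lemma : ∀ β → β + (2 + β) ≡ (2 + 2 * β) + 2 * 0
        lemma = solve-∀
share-total β (suc (suc _)) (suc (suc _)) = lemma β
  where lemma : ∀ β → (1 + β) + (1 + β) ≡ (2 + 2 * β) + 2 * 0
        lemma = solve-∀

β≤share : ∀ β d d′ → β ≤ share β d d′
β≤share β 0 0             = n≤1+n β
β≤share β 0 1             = ≤-refl
β≤share β 0 (suc (suc _)) = n≤1+n β
β≤share β 1 _             = m≤n+m β 2
β≤share β (suc (suc _)) 0 = n≤1+n β
β≤share β (suc (suc _)) 1 = ≤-refl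
β≤share β (suc (suc _)) (suc (suc _)) = n≤1+n β

nonleaf⇒β<share : ∀ β d {d′} → d′ ≢ 1 → β < share β d d′
nonleaf⇒β<share β d {1} d′≢1 = contradiction refl d′≢1
nonleaf⇒β<share β 0 {0} _ = ≤-refl
nonleaf⇒β<share β 0 {suc (suc _)} _ = ≤-refl
nonleaf⇒β<share β 1 {0} _ = n≤1+n _
nonleaf⇒β<share β 1 {suc (suc _)} _ = n≤1+n _
nonleaf⇒β<share β (suc (suc _)) {0} _ = ≤-refl
nonleaf⇒β<share β (suc (suc _)) {suc (suc _)} _ = ≤-refl

emptyRows isolatedEdges : ∀ {n m} → Edges n m → ℕ
emptyRows E = sum (isZero ∘ deg E)
isolatedEdges E = sum λ i → sum λ j → 𝟙 (E i j) * bothLeaves (deg E i) (deg (flip E) j)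

-- The target per line is `2 + β`. `β = 2` is the rule of 3 units per edge and 2 per line, doubled
-- to avoid halves; `β = 1` spends 4 per edge with target 3.
received : ∀ {n m} → ℕ → Edges n m → Fin n → ℕ
received β E i = sum λ j → 𝟙 (E i j) * share β (deg E i) (deg (flip E) j)

module _ {n m : ℕ} (β : ℕ) (E : Edges n m) where

  -- Double counting: after exchanging the sums on the column side, `share-total` is added up over
  -- all edges.
  received-total : sum (received β E) + sum (received β (flip E)) ≡
                   (2 + 2 * β) * size E + 2 * isolatedEdges E
  received-total = begin-equality
    sum (received β E) + sum (received β (flip E))
      ≡⟨ cong (sum (received β E) +_) (∑-comm λ j i → 𝟙 (E i j) * share β (d′ j) (d i)) ⟩
    sum (λ i → sum (s i)) + sum (λ i → sum (s′ i))
      ≡⟨ ∑-distrib-+ (sum ∘ s) (sum ∘ s′) ⟨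
    sum (λ i → sum (s i) + sum (s′ i))
      ≡⟨ sum-cong-≗ row ⟩
    sum (λ i → (2 + 2 * β) * deg E i + 2 * sum (l i))
      ≡⟨ ∑-distrib-+ (λ i → (2 + 2 * β) * deg E i) (λ i → 2 * sum (l i)) ⟩
    sum (λ i → (2 + 2 * β) * deg E i) + sum (λ i → 2 * sum (l i))
      ≡⟨ cong₂ _+_ (*-distribˡ-sum (2 + 2 * β) (deg E)) (*-distribˡ-sum 2 (sum ∘ l)) ⟨
    (2 + 2 * β) * size E + 2 * isolatedEdges E ∎
    where
    open ≤-Reasoning
    d = deg E
    d′ = deg (flip E)
    s s′ l : Fin n → Fin m → ℕ
    s  i j = 𝟙 (E i j) * share β (d i) (d′ j)
    s′ i j = 𝟙 (E i j) * share β (d′ j) (d i)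
    l  i j = 𝟙 (E i j) * bothLeaves (d i) (d′ j)
    distrib : ∀ x c l → x * (c + 2 * l) ≡ c * x + 2 * (x * l)
    distrib = solve-∀
    entry : ∀ i j → s i j + s′ i j ≡ (2 + 2 * β) * 𝟙 (E i j) + 2 * l i j
    entry i j = trans (sym (*-distribˡ-+ (𝟙 (E i j)) (share β (d i) (d′ j)) _))
      (trans (cong (𝟙 (E i j) *_) (share-total β (d i) (d′ j)))
        (distrib (𝟙 (E i j)) (2 + 2 * β) (bothLeaves (d i) (d′ j))))
    row : ∀ i → sum (s i) + sum (s′ i) ≡ (2 + 2 * β) * deg E i + 2 * sum (l i)
    row i = begin-equality
      sum (s i) + sum (s′ i)
        ≡⟨ ∑-distrib-+ (s i) (s′ i) ⟨
      sum (λ j → s i j + s′ i j)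
        ≡⟨ sum-cong-≗ (entry i) ⟩
      sum (λ j → (2 + 2 * β) * 𝟙 (E i j) + 2 * l i j)
        ≡⟨ ∑-distrib-+ (λ j → (2 + 2 * β) * 𝟙 (E i j)) (λ j → 2 * l i j) ⟩
      sum (λ j → (2 + 2 * β) * 𝟙 (E i j)) + sum (λ j → 2 * l i j)
        ≡⟨ cong₂ _+_ (*-distribˡ-sum (2 + 2 * β) (𝟙 ∘ E i)) (*-distribˡ-sum 2 (l i)) ⟨
      (2 + 2 * β) * deg E i + 2 * sum (l i) ∎

  β*deg≤received : ∀ i → β * deg E i ≤ received β E i
  β*deg≤received i = subst (_≤ received β E i) (sym (*-distribˡ-sum β (𝟙 ∘ E i)))
    (sum-mono λ j → ≤-trans (≤-reflexive (*-comm β (𝟙 (E i j))))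
      (*-monoʳ-≤ (𝟙 (E i j)) (β≤share β (deg E i) (deg (flip E) j))))

  β*deg<received : ∀ {i} → HasNonleafNeighbour E i → β * deg E i < received β E i
  β*deg<received {i} (j , e , d≢1) = subst (_< received β E i) (sym (*-distribˡ-sum β (𝟙 ∘ E i)))
    (sum-mono-< (λ j → ≤-trans (≤-reflexive (*-comm β (𝟙 (E i j))))
      (*-monoʳ-≤ (𝟙 (E i j)) (β≤share β (deg E i) (deg (flip E) j)))) j strict)
    where
    strict : β * 𝟙 (E i j) < 𝟙 (E i j) * share β (deg E i) (deg (flip E) j)
    strict rewrite e | *-identityʳ β | +-identityʳ (share β (deg E i) (deg (flip E) j)) =
      nonleaf⇒β<share β (deg E i) d≢1

  leaf-received : ∀ {i} → deg E i ≡ 1 → 2 + β ≤ received β E i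
  leaf-received {i} d≡1 = begin
    2 + β                        ≡⟨ *-identityʳ (2 + β) ⟨
    (2 + β) * 1                  ≡⟨ cong ((2 + β) *_) d≡1 ⟨
    (2 + β) * deg E i            ≡⟨ *-distribˡ-sum (2 + β) (𝟙 ∘ E i) ⟩
    sum (λ j → (2 + β) * 𝟙 (E i j)) ≤⟨ sum-mono (λ j → ≤-reflexive (trans (*-comm (2 + β) (𝟙 (E i j)))
                                        (cong (λ d → 𝟙 (E i j) * share β d (deg (flip E) j)) (sym d≡1)))) ⟩
    received β E i               ∎
    where open ≤-Reasoning

  -- Every edge gives at least `β`. At degree 2 the nonleaf neighbour adds something extra; beyond
  -- that a third edge does.
  heavy-received : 1 ≤ β → ∀ {i} → 2 ≤ deg E i → (deg E i ≡ 2 → HasNonleafNeighbour E i) →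
                   β * 2 < received β E i
  heavy-received 1≤β {i} 2≤d nonleaf with deg E i ≟ 2
  ... | yes d≡2 = subst (λ d → β * d < received β E i) d≡2 (β*deg<received (nonleaf d≡2))
  ... | no  d≢2 = <-≤-trans (*-monoʳ-< β {{>-nonZero 1≤β}} (≤∧≢⇒< 2≤d (≢-sym d≢2))) (β*deg≤received i)

  -- The rule suffices for every row when β = 2; when β = 1 rows that are the centre
  -- of a component P₃ have to be excluded.
  received-enough : 1 ≤ β → (∀ {i} → deg E i ≡ 2 → 2 ≤ β ⊎ HasNonleafNeighbour E i) →
                    ∀ i → 2 + β ≤ received β E i + (2 + β) * isZero (deg E i)
  received-enough 1≤β h i with deg E i ≟ 0 | deg E i ≟ 1
  ... | yes d≡0 | _ = subst (λ d → 2 + β ≤ received β E i + (2 + β) * isZero d) (sym d≡0)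
    (≤-trans (≤-reflexive (sym (*-identityʳ (2 + β)))) (m≤n+m _ (received β E i)))
  ... | no _ | yes d≡1 = ≤-trans (leaf-received d≡1) (m≤m+n _ _)
  ... | no d≢0 | no d≢1 = ≤-trans enough (m≤m+n _ _)
    where
    -- A strict gain over `β * 2` reaches the target for all `β ≥ 1`; for `β ≥ 2` the value `β * 2`
    -- already does.
    2+β≤ : ∀ β → 1 ≤ β → 2 + β ≤ suc (β * 2)
    2+β≤ (suc β) _ = s≤s (s≤s (s≤s (m≤m*n β 2)))
    2+β≤′ : 2 ≤ β → 2 + β ≤ β * 2
    2+β≤′ 2≤β = subst (2 + β ≤_) (trans (cong (β +_) (sym (+-identityʳ β))) (*-comm 2 β)) (+-monoˡ-≤ β 2≤β)
    2≤d : 2 ≤ deg E i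
    2≤d = ≤∧≢⇒< (n≢0⇒n>0 d≢0) (≢-sym d≢1)
    enough : 2 + β ≤ received β E i
    enough with deg E i ≟ 2
    ... | no d≢2 = ≤-trans (2+β≤ β 1≤β) (heavy-received 1≤β 2≤d λ d≡2 → contradiction d≡2 d≢2)
    ... | yes d≡2 with h d≡2
    ...   | inj₁ 2≤β = ≤-trans (2+β≤′ 2≤β) (≤-trans (*-monoʳ-≤ β 2≤d) (β*deg≤received i))
    ...   | inj₂ nl  = ≤-trans (2+β≤ β 1≤β) (heavy-received 1≤β 2≤d λ _ → nl)

  -- Empty lines are credited a fictitious `2 + β`. The bounds `x` and `y` stay free so that one
  -- side can be made strict.
  discharge : ∀ {x y} → x ≤ sum (λ i → received β E i + (2 + β) * isZero (deg E i)) →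
    y ≤ sum (λ j → received β (flip E) j + (2 + β) * isZero (deg (flip E) j)) →
    x + y ≤ (2 + 2 * β) * size E + 2 * isolatedEdges E + (2 + β) * (emptyRows E + emptyRows (flip E))
  discharge {x} {y} x≤ y≤ = begin
    x + y
      ≤⟨ +-mono-≤ x≤ y≤ ⟩
    _ ≡⟨ cong₂ _+_ (split n m E) (split m n (flip E)) ⟩
    (sum (received β E) + (2 + β) * emptyRows E) + (sum (received β (flip E)) + (2 + β) * emptyRows (flip E))
      ≡⟨ regroup (sum (received β E)) (emptyRows E) (sum (received β (flip E))) (emptyRows (flip E)) (2 + β) ⟩
    (sum (received β E) + sum (received β (flip E))) + (2 + β) * (emptyRows E + emptyRows (flip E))
      ≡⟨ cong (_+ (2 + β) * (emptyRows E + emptyRows (flip E))) received-total ⟩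
    _ ∎
    where
    open ≤-Reasoning
    split : ∀ n m (E : Edges n m) → sum (λ i → received β E i + (2 + β) * isZero (deg E i)) ≡
                                    sum (received β E) + (2 + β) * emptyRows E
    split n m E = trans (∑-distrib-+ (received β E) λ i → (2 + β) * isZero (deg E i))
      (cong (sum (received β E) +_) (sym (*-distribˡ-sum (2 + β) (isZero ∘ deg E))))
    regroup : ∀ a b c d x → (a + x * b) + (c + x * d) ≡ (a + c) + x * (b + d)
    regroup = solve-∀

-- Empty lines and isolated edges of a separating graph.

isZero≤1 : ∀ d → isZero d ≤ 1
isZero≤1 zero    = ≤-refl
isZero≤1 (suc _) = z≤n

isZero≢0 : ∀ {d} → isZero d ≢ 0 → d ≡ 0
isZero≢0 {zero}  _  = refl
isZero≢0 {suc _} ≢0 = contradiction refl ≢0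

bothLeaves≤1 : ∀ d d′ → bothLeaves d d′ ≤ 1
bothLeaves≤1 0 _ = z≤n
bothLeaves≤1 1 0 = z≤n
bothLeaves≤1 1 1 = ≤-refl
bothLeaves≤1 1 (suc (suc _)) = z≤n
bothLeaves≤1 (suc (suc _)) _ = z≤n

bothLeaves≢0 : ∀ {d d′} → bothLeaves d d′ ≢ 0 → d ≡ 1 × d′ ≡ 1
bothLeaves≢0 {0} ≢0 = contradiction refl ≢0
bothLeaves≢0 {1} {0} ≢0 = contradiction refl ≢0
bothLeaves≢0 {1} {1} _ = refl , refl
bothLeaves≢0 {1} {suc (suc _)} ≢0 = contradiction refl ≢0
bothLeaves≢0 {suc (suc _)} ≢0 = contradiction refl ≢0

all≤⇒*≤sum : ∀ {n k} {f : Fin n → ℕ} → (∀ i → k ≤ f i) → n * k ≤ sum f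
all≤⇒*≤sum {n} {k} k≤f = subst (_≤ _) (sum-const n k) (sum-mono k≤f)

module _ {n m : ℕ} (E : Edges n m) (sep : Separating E) where

  emptyRow : emptyRows E ≢ 0 → ∃[ i ] deg E i ≡ 0
  emptyRow ≢0 with i , p ← sum≢0⇒∃ (isZero ∘ deg E) ≢0 = i , isZero≢0 p

  emptyRows≤1 : 0 < m → emptyRows E ≤ 1
  emptyRows≤1 0<m = sum≤1 _ (isZero≤1 ∘ deg E) λ i j p q →
    empty-unique E sep 0<m (isZero≢0 p) (isZero≢0 q)

  private
    isolated? : Fin n → Fin m → ℕ
    isolated? i j = 𝟙 (E i j) * bothLeaves (deg E i) (deg (flip E) j)

    isolated⇒edge : ∀ {i j} → isolated? i j ≢ 0 → E i j ≡ true
    isolated⇒edge {i} {j} ≢0 = 𝟙≢0 λ 𝟙≡0 → ≢0 (cong (_* bothLeaves (deg E i) (deg (flip E) j)) 𝟙≡0)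

    isolated⇒agree : ∀ {i j} → isolated? i j ≢ 0 → ∀ {a b} → E a b ≡ true → Agree i j a b
    isolated⇒agree {i} {j} ≢0 e
      with d≡1 , d′≡1 ← bothLeaves≢0 {deg E i} {deg (flip E) j}
             (λ b≡0 → ≢0 (trans (cong (𝟙 (E i j) *_) b≡0) (*-zeroʳ (𝟙 (E i j))))) =
      (λ { refl → leaf-unique E d≡1 e (isolated⇒edge ≢0) }) ,
      (λ { refl → leaf-unique (flip E) d′≡1 e (isolated⇒edge ≢0) })

    isolated?≤1 : ∀ i j → isolated? i j ≤ 1
    isolated?≤1 i j = *-mono-≤ (𝟙≤1 (E i j)) (bothLeaves≤1 (deg E i) (deg (flip E) j))

  isolatedEdges≤1 : isolatedEdges E ≤ 1
  isolatedEdges≤1 = sum-sum≤1 isolated? isolated?≤1 λ p q →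
    isolated-unique E sep (isolated⇒agree p) (isolated⇒agree q)

  -- By `isolated-unique` an isolated edge would have to be `(i₀ , j₀)`, whose row is empty.
  no-isolatedEdges : ∀ {i₀ j₀} → deg E i₀ ≡ 0 → deg (flip E) j₀ ≡ 0 → isolatedEdges E ≡ 0
  no-isolatedEdges {i₀} {j₀} d₀≡0 d₀′≡0 = decidable-stable (isolatedEdges E ≟ 0) λ ≢0 →
    let i , p = sum≢0⇒∃ (sum ∘ isolated?) ≢0
        j , q = sum≢0⇒∃ (isolated? i) p
        i≡i₀ , _ = isolated-unique E sep (isolated⇒agree q) λ e →
          (λ { refl → contradiction d₀≡0 (edge⇒deg≢0 E e) }) ,
          (λ { refl → contradiction d₀′≡0 (edge⇒deg≢0 (flip E) e) })
    in edge⇒deg≢0 E (isolated⇒edge q) (subst (λ i → deg E i ≡ 0) (sym i≡i₀) d₀≡0)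

  enough₂ : ∀ i → 4 ≤ received 2 E i + 4 * isZero (deg E i)
  enough₂ = received-enough 2 E (s≤s z≤n) λ _ → inj₁ ≤-refl

-- The lower bound on the number of edges.

-- Equivalent to `2 * (n + m) / 3 ≤ size E`, without division.
Bound : ∀ {n m} → Edges n m → Set
Bound {n} {m} E = 2 * (n + m) ≤ 3 * size E + 2

-- Both sides are even, so a total excess strictly below 6 suffices for `Bound`.
halve : ∀ {n m e} → n * 4 + m * 4 < 6 * e + 6 → 2 * (n + m) ≤ 3 * e + 2
halve {n} {m} {e} lt = s≤s⁻¹ (subst (suc (2 * (n + m)) ≤_) (+-suc (3 * e) 2)
  (*-cancelˡ-< 2 (2 * (n + m)) (3 * e + 3) (subst₂ _<_ (lhs n m) (rhs e) lt)))
  where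
  lhs : ∀ n m → n * 4 + m * 4 ≡ 2 * (2 * (n + m))
  lhs = solve-∀
  rhs : ∀ e → 6 * e + 6 ≡ 2 * (3 * e + 3)
  rhs = solve-∀

total≤ : ∀ c {e} w {k a r b} → k ≤ a → r ≤ b → c * e + 2 * k + w * r ≤ c * e + (2 * a + w * b)
total≤ c {e} w {k} {a} {r} {b} k≤a r≤b = ≤-trans (≤-reflexive (+-assoc (c * e) (2 * k) (w * r)))
  (+-monoʳ-≤ (c * e) (+-mono-≤ (*-monoʳ-≤ 2 k≤a) (*-monoʳ-≤ w r≤b)))

0<half : ∀ {n m} → n < 2 * m → 0 < m
0<half {m = suc _} _ = s≤s z≤n

-- The excess is 2 for an isolated edge plus 4 for an empty row, which just misses the strictness
-- that `halve` asks for.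
bound₂ : ∀ {n m} (E : Edges n m) → Separating E → 0 < m → emptyRows (flip E) ≡ 0 →
         n * 4 + m * 4 ≤ 6 * size E + 6
bound₂ E sep 0<m noEmptyCol = ≤-trans
  (discharge 2 E (all≤⇒*≤sum (enough₂ E sep)) (all≤⇒*≤sum (enough₂ (flip E) (Separating-flip E sep))))
  (total≤ 6 {size E} 4 (isolatedEdges≤1 E sep) (+-mono-≤ (emptyRows≤1 E sep 0<m) (≤-reflexive noEmptyCol)))

-- With an empty row and an isolated edge the count would be one third short
-- if every other component were a P₃ centred in a column. Then all rows have
-- degree at most 1, so that size E < n, which contradicts n < 2 m.
bound-emptyRow : ∀ {n m} (E : Edges n m) → Separating E → 0 < m → n < 2 * m →
                 ∀ {i₀} → deg E i₀ ≡ 0 → emptyRows (flip E) ≡ 0 → Bound E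
bound-emptyRow {n} {m} E sep 0<m n<2m {i₀} d₀≡0 noEmptyCol
  with any? (λ i → 2 ≤? deg E i)
... | yes (i , 2≤d) = halve {n} {m} {size E} (<-≤-trans (discharge 2 E heavy light) small)
  where
  -- A row of degree at least 2 receives more than its target 4, which supplies the missing
  -- strictness.
  heavy : suc (n * 4) ≤ sum (λ i → received 2 E i + 4 * isZero (deg E i))
  heavy = ≤-<-trans (≤-reflexive (sym (sum-const n 4))) (sum-mono-< (enough₂ E sep) i
    (≤-trans (heavy-received 2 E (s≤s z≤n) 2≤d (empty⇒nonleaf-neighbour E sep d₀≡0)) (m≤m+n _ _)))
  light : m * 4 ≤ sum (λ j → received 2 (flip E) j + 4 * isZero (deg (flip E) j))
  light = all≤⇒*≤sum (enough₂ (flip E) (Separating-flip E sep))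
  small : 6 * size E + 2 * isolatedEdges E + 4 * (emptyRows E + emptyRows (flip E)) ≤ 6 * size E + 6
  small = total≤ 6 {size E} 4 (isolatedEdges≤1 E sep) 
    (+-mono-≤ (emptyRows≤1 E sep 0<m) (≤-reflexive noEmptyCol))
... | no  none = contradiction n<2m (≤⇒≯ (+-cancelˡ-≤ (2 * n) (2 * m) n 2n+2m≤3n))
  where
  deg≤1 : ∀ i → deg E i ≤ 1
  deg≤1 i = s≤s⁻¹ (≰⇒> λ 2≤d → none (i , 2≤d))
  size<n : size E < n
  size<n = subst (size E <_) (trans (sum-const n 1) (*-identityʳ n))
    (sum-mono-< deg≤1 i₀ (≤-reflexive (cong suc d₀≡0)))
  lhs : ∀ n m → n * 4 + m * 4 ≡ 2 * (2 * n + 2 * m)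
  lhs = solve-∀
  rhs : ∀ e → 6 * e + 6 ≡ 2 * (3 * (1 + e))
  rhs = solve-∀
  three : ∀ n → 3 * n ≡ 2 * n + n
  three = solve-∀
  -- Half of `bound₂` gives `2 * n + 2 * m ≤ 3 * (1 + size E) ≤ 3 * n`, hence `2 * m ≤ n`.
  2n+2m≤3n : 2 * n + 2 * m ≤ 2 * n + n
  2n+2m≤3n = ≤-trans (*-cancelˡ-≤ 2 (subst₂ _≤_ (lhs n m) (rhs (size E)) (bound₂ E sep 0<m noEmptyCol)))
    (≤-trans (*-monoʳ-≤ 3 size<n) (≤-reflexive (three n)))

lower-bound : ∀ {n m} (E : Edges n m) → Separating E →
              n < 2 * m → m < 2 * n → 12 ≤ n + m → Bound E
lower-bound {n} {m} E sep n<2m m<2n 12≤n+m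
  with emptyRows E ≟ 0 | emptyRows (flip E) ≟ 0
... | yes noRow | yes noCol = halve {n} {m} {size E} (≤-<-trans
    (≤-trans (discharge 2 E (all≤⇒*≤sum (enough₂ E sep)) (all≤⇒*≤sum (enough₂ (flip E) (Separating-flip E sep))))
      (total≤ 6 {size E} 4 (isolatedEdges≤1 E sep) (≤-reflexive (cong₂ _+_ noRow noCol))))
    (+-monoʳ-< (6 * size E) (s≤s (s≤s (s≤s z≤n)))))
... | no row | yes noCol =
  bound-emptyRow E sep (0<half n<2m) n<2m (proj₂ (emptyRow E sep row)) noCol
... | yes noRow | no col = subst₂ (λ a b → 2 * a ≤ 3 * b + 2) (+-comm m n) (size-flip E)
  (bound-emptyRow (flip E) sep′ (0<half m<2n) m<2n (proj₂ (emptyRow (flip E) sep′ col)) noRow)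
  where
  sep′ : Separating (flip E)
  sep′ = Separating-flip E sep
-- Here `β = 1`, with excess 6 from the two empty lines. If `Bound` failed, then for `N = n + m` one
-- would have `9 N ≤ 12 |E| + 18 = 4 (3 |E| + 3) + 6 ≤ 8 N + 6`, so `N ≤ 6`.
... | no row | no col = s≤s⁻¹ (≰⇒> λ big → <⇒≱ (s≤s (s≤s (s≤s (s≤s (s≤s (s≤s (s≤s z≤n)))))))
    (≤-trans 12≤n+m (+-cancelˡ-≤ (8 * (n + m)) (n + m) 6 (begin
      8 * (n + m) + (n + m)      ≡⟨ nine n m ⟩
      3 * (n * 3 + m * 3)        ≤⟨ *-monoʳ-≤ 3 count ⟩
      3 * (4 * size E + 6)       ≡⟨ regroup (size E) ⟩
      4 * suc (3 * size E + 2) + 6 ≤⟨ +-monoˡ-≤ 6 (*-monoʳ-≤ 4 big) ⟩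
      4 * (2 * (n + m)) + 6      ≡⟨ cong (_+ 6) (*-assoc 4 2 (n + m)) ⟨
      8 * (n + m) + 6            ∎))))
  where
  open ≤-Reasoning
  sep′ : Separating (flip E)
  sep′ = Separating-flip E sep
  nine : ∀ n m → 8 * (n + m) + (n + m) ≡ 3 * (n * 3 + m * 3)
  nine = solve-∀
  regroup : ∀ e → 3 * (4 * e + 6) ≡ 4 * (1 + (3 * e + 2)) + 6
  regroup = solve-∀
  d₀≡0 : deg E (proj₁ (emptyRow E sep row)) ≡ 0
  d₀≡0 = proj₂ (emptyRow E sep row)
  d₀′≡0 : deg (flip E) (proj₁ (emptyRow (flip E) sep′ col)) ≡ 0
  d₀′≡0 = proj₂ (emptyRow (flip E) sep′ col)
  count : n * 3 + m * 3 ≤ 4 * size E + 6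
  count = ≤-trans
    (discharge 1 E
      (all≤⇒*≤sum (received-enough 1 E ≤-refl λ d≡2 → inj₂ (empty⇒nonleaf-neighbour E sep d₀≡0 d≡2)))
      (all≤⇒*≤sum (received-enough 1 (flip E) ≤-refl λ d≡2 → inj₂ (empty⇒nonleaf-neighbour (flip E) sep′ d₀′≡0 d≡2))))
    (total≤ 4 {size E} 3 (≤-reflexive (no-isolatedEdges E sep d₀≡0 d₀′≡0))
      (+-mono-≤ (emptyRows≤1 E sep (0<half n<2m)) (emptyRows≤1 (flip E) sep′ (0<half m<2n))))

-- From identifying codes to separating graphs.

module _ {n m : ℕ} where

  private
    G : Graph
    G = K n ×ᴳ K m

  N⇔Agree : ∀ {i j a b} → N[_] {G} (i , j) (a , b) ⇔ Agree i j a b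
  N⇔Agree {i} {j} {a} {b} = mk⇔ to from
    where
    to : N[_] {G} (i , j) (a , b) → Agree i j a b
    to (inj₁ refl)          = (λ _ → refl) , (λ _ → refl)
    to (inj₂ (i≢a , j≢b)) = (λ a≡i → contradiction (sym a≡i) i≢a) , (λ b≡j → contradiction (sym b≡j) j≢b)
    from : Agree i j a b → N[_] {G} (i , j) (a , b)
    from (f , g) with a Fin.≟ i
    ... | yes a≡i = inj₁ (cong₂ _,_ a≡i (f a≡i))
    ... | no  a≢i = inj₂ (≢-sym a≢i , λ j≡b → a≢i (g (sym j≡b)))

  _≟×_ : DecidableEquality (Fin n × Fin m)
  _≟×_ = ≡-dec Fin._≟_ Fin._≟_

  open import Data.List.Membership.DecPropositional _≟×_ using (_∈?_)

  codeEdges : List (Fin n × Fin m) → Edges n m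
  codeEdges C i j = does ((i , j) ∈? C)

  ∈⇒edge : ∀ {C i j} → (i , j) ∈ C → codeEdges C i j ≡ true
  ∈⇒edge {C} {i} {j} = dec-true ((i , j) ∈? C)

  separating : ∀ {C} → IsIDCode G C → Separating (codeEdges C)
  separating {C} (_ , separates) {i} {j} {i′} {j′} h
    with (i , j) ≟× (i′ , j′)
  ... | yes refl = refl , refl
  ... | no  x≢y  = ⊥-elim (separates (i , j) (i′ , j′) x≢y
    ((λ (c∈N , c∈C) → N⇔Agree .from (h (∈⇒edge c∈C) .to (N⇔Agree .to c∈N)) , c∈C) ,
     (λ (c∈N , c∈C) → N⇔Agree .from (h (∈⇒edge c∈C) .from (N⇔Agree .to c∈N)) , c∈C)))
    where open Equivalence

  -- Prepending `c` changes the graph at most in the position `c`. Repeated entries make the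
  -- inequality strict.
  size≤length : ∀ C → size (codeEdges C) ≤ length C
  size≤length [] = ≤-reflexive (trans (sum-cong-≗ {n} (λ _ → trans (sum-const m 0) (*-zeroʳ m)))
                                      (trans (sum-const n 0) (*-zeroʳ n)))
  size≤length (c ∷ C) = begin
    size (codeEdges (c ∷ C))
      ≤⟨ sum-mono (λ i → sum-mono λ j → 𝟙-∨ (does ((i , j) ≟× c)) (codeEdges C i j)) ⟩
    sum (λ i → sum λ j → first i j + 𝟙 (codeEdges C i j))
      ≡⟨ sum-cong-≗ (λ i → ∑-distrib-+ (first i) (𝟙 ∘ codeEdges C i)) ⟩
    sum (λ i → sum (first i) + deg (codeEdges C) i)
      ≡⟨ ∑-distrib-+ (sum ∘ first) (deg (codeEdges C)) ⟩
    sum (sum ∘ first) + size (codeEdges C)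
      ≤⟨ +-mono-≤ (sum-sum≤1 first (λ i j → 𝟙≤1 (does ((i , j) ≟× c))) first-unique) (size≤length C) ⟩
    suc (length C) ∎
    where
    open ≤-Reasoning
    first : Fin n → Fin m → ℕ
    first i j = 𝟙 (does ((i , j) ≟× c))
    first⇒≡ : ∀ {i j} → first i j ≢ 0 → (i , j) ≡ c
    first⇒≡ {i} {j} ≢0 with (i , j) ≟× c
    ... | yes x≡c = x≡c
    ... | no  _   = contradiction refl ≢0
    first-unique : ∀ {i j i′ j′} → first i j ≢ 0 → first i′ j′ ≢ 0 → i ≡ i′ × j ≡ j′
    first-unique {i} {j} {i′} {j′} p q with first⇒≡ {i} {j} p | first⇒≡ {i′} {j′} q
    ... | refl | refl = refl , refl
    𝟙-∨ : ∀ a b → 𝟙 (a ∨ b) ≤ 𝟙 a + 𝟙 b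
    𝟙-∨ true  b = s≤s z≤n
    𝟙-∨ false b = ≤-refl


-- From bipartite graphs to identifying codes.

-- A graph with edges `I` and end maps `ρ`, `σ`. Free index types allow sums and products in place
-- of arithmetic in `Fin`. `avoid` yields domination; the surjectivity fields and `unclosed` yield
-- identification.
record IncidenceWitness (R L I : Set) (ρ : I → R) (σ : I → L) : Set where
  field
    injective : ∀ {x y} → ρ x ≡ ρ y → σ x ≡ σ y → x ≡ y
    ρ-surj    : ∀ r → ∃[ x ] ρ x ≡ r
    σ-surj    : ∀ l → ∃[ x ] σ x ≡ l
    avoid     : ∀ r l → ∃[ x ] ρ x ≢ r × σ x ≢ l
    unclosed  : ∀ {r r′ l l′} → r ≢ r′ → l ≢ l′ →
                ¬ (∀ x → (ρ x ≡ r ⊎ ρ x ≡ r′) ⇔ (σ x ≡ l ⊎ σ x ≡ l′))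

-- A code with no empty row and no empty column is identifying as soon as no two
-- rows and two columns together form a union of connected components.
module _ {n m e : ℕ} {R L I : Set} {ρ : I → R} {σ : I → L}
         (n↔R : Fin n ↔ R) (m↔L : Fin m ↔ L) (e↔I : Fin e ↔ I)
         (witness : IncidenceWitness R L I ρ σ) where

  open IncidenceWitness witness
  open Inverse

  private
    G : Graph
    G = K n ×ᴳ K m

    vertex : I → Fin n × Fin m
    vertex x = n↔R .from (ρ x) , m↔L .from (σ x)

    code : List (Fin n × Fin m)
    code = tabulate (vertex ∘ e↔I .to)

    vertex∈code : ∀ x → vertex x ∈ code
    vertex∈code x = subst (λ y → vertex y ∈ code) (strictlyInverseˡ e↔I x) (∈-tabulate⁺ (e↔I .from x))

    _≟R_ : DecidableEquality R
    _≟R_ = via-injection (↔⇒↣ (↔-sym n↔R)) Fin._≟_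

    _≟L_ : DecidableEquality L
    _≟L_ = via-injection (↔⇒↣ (↔-sym m↔L)) Fin._≟_

    from-swap : ∀ {k} {A : Set} (k↔A : Fin k ↔ A) {i a} → (a ≡ k↔A .to i) ⇔ (k↔A .from a ≡ i)
    from-swap k↔A = mk⇔ (inverseʳ k↔A) (sym ∘ inverseˡ k↔A ∘ sym)

    AgreeAt : R → L → I → Set
    AgreeAt r l x = (ρ x ≡ r → σ x ≡ l) × (σ x ≡ l → ρ x ≡ r)

    separated : ∀ {r l r′ l′} → (∀ x → AgreeAt r l x ⇔ AgreeAt r′ l′ x) → r ≡ r′ × l ≡ l′
    separated {r} {l} {r′} {l′} h with r ≟R r′ | l ≟L l′
    ... | yes r≡r′ | yes l≡l′ = r≡r′ , l≡l′
    -- An edge `x` in column `l` cannot lie in row `r`, since agreeing with `(r , l′)` would put it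
    -- in column `l′`. So it agrees vacuously with `(r , l′)` but not with `(r , l)`.
    ... | yes refl | no  l≢l′ = ⊥-elim (ρx≢r (h x .from ((λ ρx≡r → contradiction ρx≡r ρx≢r) ,
                                                          (λ σx≡l′ → contradiction (trans (sym σx≡l) σx≡l′) l≢l′)) .proj₂ σx≡l))
      where
      open Equivalence
      x = σ-surj l .proj₁
      σx≡l = σ-surj l .proj₂
      ρx≢r : ρ x ≢ r
      ρx≢r ρx≡r = l≢l′ (trans (sym σx≡l) (h x .to ((λ _ → σx≡l) , (λ _ → ρx≡r)) .proj₁ ρx≡r))
    ... | no  r≢r′ | yes refl = ⊥-elim (σx≢l (h x .from ((λ ρx≡r′ → contradiction (trans (sym ρx≡r) ρx≡r′) r≢r′) ,
                                                          (λ σx≡l → contradiction σx≡l σx≢l)) .proj₁ ρx≡r))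
      where
      open Equivalence
      x = ρ-surj r .proj₁
      ρx≡r = ρ-surj r .proj₂
      σx≢l : σ x ≢ l
      σx≢l σx≡l = r≢r′ (trans (sym ρx≡r) (h x .to ((λ _ → σx≡l) , (λ _ → ρx≡r)) .proj₂ σx≡l))
    -- An edge at, say, `r` that misses both columns would agree vacuously with `(r′ , l′)` but not
    -- with `(r , l)`. Hence the four lines would be a union of components.
    ... | no  r≢r′ | no  l≢l′ = ⊥-elim (unclosed r≢r′ l≢l′ λ x → mk⇔ (to′ x) (from′ x))
      where
      open Equivalence
      to′ : ∀ x → ρ x ≡ r ⊎ ρ x ≡ r′ → σ x ≡ l ⊎ σ x ≡ l′
      to′ x ρx∈ with σ x ≟L l | σ x ≟L l′ | ρx∈
      ... | yes σx≡l | _ | _ = inj₁ σx≡l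
      ... | no _ | yes σx≡l′ | _ = inj₂ σx≡l′
      ... | no σx≢l | no σx≢l′ | inj₁ ρx≡r = inj₁ (h x .from ((λ ρx≡r′ → contradiction (trans (sym ρx≡r) ρx≡r′) r≢r′) ,
                                                             (λ σx≡l′ → contradiction σx≡l′ σx≢l′)) .proj₁ ρx≡r)
      ... | no σx≢l | no σx≢l′ | inj₂ ρx≡r′ = inj₂ (h x .to ((λ ρx≡r → contradiction (trans (sym ρx≡r) ρx≡r′) r≢r′) ,
                                                             (λ σx≡l → contradiction σx≡l σx≢l)) .proj₁ ρx≡r′)
      from′ : ∀ x → σ x ≡ l ⊎ σ x ≡ l′ → ρ x ≡ r ⊎ ρ x ≡ r′
      from′ x σx∈ with ρ x ≟R r | ρ x ≟R r′ | σx∈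
      ... | yes ρx≡r | _ | _ = inj₁ ρx≡r
      ... | no _ | yes ρx≡r′ | _ = inj₂ ρx≡r′
      ... | no ρx≢r | no ρx≢r′ | inj₁ σx≡l = inj₁ (h x .from ((λ ρx≡r′ → contradiction ρx≡r′ ρx≢r′) ,
                                                             (λ σx≡l′ → contradiction (trans (sym σx≡l) σx≡l′) l≢l′)) .proj₂ σx≡l)
      ... | no ρx≢r | no ρx≢r′ | inj₂ σx≡l′ = inj₂ (h x .to ((λ ρx≡r → contradiction ρx≡r ρx≢r) ,
                                                             (λ σx≡l → contradiction (trans (sym σx≡l) σx≡l′) l≢l′)) .proj₂ σx≡l′)

  idCode : ∃[ C ] Unique C × IsIDCode G C × length C ≡ e
  idCode = code , tabulate⁺ unique , (dominating , identifying) , length-tabulate (vertex ∘ e↔I .to)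
    where
    unique : ∀ {k k′} → vertex (e↔I .to k) ≡ vertex (e↔I .to k′) → k ≡ k′
    unique eq = ↔⇒↣ e↔I .Injection.injective (injective
      (↔⇒↣ (↔-sym n↔R) .Injection.injective (cong proj₁ eq))
      (↔⇒↣ (↔-sym m↔L) .Injection.injective (cong proj₂ eq)))
    dominating : IsDominating G code
    dominating (i , j) with x , ρx≢ , σx≢ ← avoid (n↔R .to i) (m↔L .to j) =
      vertex x , vertex∈code x , inj₂ (ρx≢ ∘ from-swap n↔R .Equivalence.from , σx≢ ∘ from-swap m↔L .Equivalence.from)
    agree : ∀ {i j} x → Agree i j (vertex x .proj₁) (vertex x .proj₂) ⇔ AgreeAt (n↔R .to i) (m↔L .to j) x
    agree x = mk⇔
      (λ (f , g) → (λ ρx≡ → from-swap m↔L .from (f (from-swap n↔R .to ρx≡))) ,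
                   (λ σx≡ → from-swap n↔R .from (g (from-swap m↔L .to σx≡))))
      (λ (f , g) → (λ ρx≡ → from-swap m↔L .to (f (from-swap n↔R .from ρx≡))) ,
                   (λ σx≡ → from-swap n↔R .to (g (from-swap m↔L .from σx≡))))
      where open Equivalence
    identifying : ∀ v w → v ≢ w → ¬ ((N[_] {G} v ∩ (_∈ code)) ≐ (N[_] {G} w ∩ (_∈ code)))
    identifying (i , j) (i′ , j′) v≢w (v⊆w , w⊆v) = v≢w (cong₂ _,_
       (↔⇒↣ n↔R .Injection.injective (proj₁ eqs)) (↔⇒↣ m↔L .Injection.injective (proj₂ eqs)))
      where
      open Equivalence
      eqs : n↔R .Inverse.to i ≡ n↔R .Inverse.to i′ × m↔L .Inverse.to j ≡ m↔L .Inverse.to j′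
      eqs = separated λ x → mk⇔
        (λ ag → agree x .to (N⇔Agree .to (v⊆w (N⇔Agree .from (agree x .from ag) , vertex∈code x) .proj₁)))
        (λ ag → agree x .to (N⇔Agree .to (w⊆v (N⇔Agree .from (agree x .from ag) , vertex∈code x) .proj₁)))

-- The forest of single edges and paths P₃.

module StarForest (κ p q : ℕ) where

  -- The summands belong to `κ` isolated edges, `p` paths centred in a row and `q` paths centred in
  -- a column; `Fin 2` numbers the leaves of a path.
  Row Column Edge : Set
  Row    = Fin κ ⊎ Fin p ⊎ Fin q × Fin 2
  Column = Fin κ ⊎ Fin p × Fin 2 ⊎ Fin q
  Edge   = Fin κ ⊎ Fin p × Fin 2 ⊎ Fin q × Fin 2

  ρ : Edge → Row
  ρ (inj₁ t)              = inj₁ t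
  ρ (inj₂ (inj₁ (a , s))) = inj₂ (inj₁ a)
  ρ (inj₂ (inj₂ (k , s))) = inj₂ (inj₂ (k , s))

  σ : Edge → Column
  σ (inj₁ t)              = inj₁ t
  σ (inj₂ (inj₁ (a , s))) = inj₂ (inj₁ (a , s))
  σ (inj₂ (inj₂ (k , s))) = inj₂ (inj₂ k)

  Closed : Row → Row → Column → Column → Set
  Closed r r′ l l′ = ∀ x → (ρ x ≡ r ⊎ ρ x ≡ r′) ⇔ (σ x ≡ l ⊎ σ x ≡ l′)

  Closed-swapᵣ : ∀ {r r′ l l′} → Closed r r′ l l′ → Closed r′ r l l′
  Closed-swapᵣ h x = mk⇔ (to (h x) ∘ Sum.swap) (Sum.swap ∘ from (h x))
    where open Equivalence

  Closed-swapₗ : ∀ {r r′ l l′} → Closed r r′ l l′ → Closed r r′ l′ l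
  Closed-swapₗ h x = mk⇔ (Sum.swap ∘ to (h x)) (from (h x) ∘ Sum.swap)
    where open Equivalence

  ρ-surj : ∀ r → ∃[ x ] ρ x ≡ r
  ρ-surj (inj₁ t)              = inj₁ t , refl
  ρ-surj (inj₂ (inj₁ a))       = inj₂ (inj₁ (a , zero)) , refl
  ρ-surj (inj₂ (inj₂ (k , s))) = inj₂ (inj₂ (k , s)) , refl

  σ-surj : ∀ l → ∃[ x ] σ x ≡ l
  σ-surj (inj₁ t)              = inj₁ t , refl
  σ-surj (inj₂ (inj₁ (a , s))) = inj₂ (inj₁ (a , s)) , refl
  σ-surj (inj₂ (inj₂ k))       = inj₂ (inj₂ (k , zero)) , refl

  injective : ∀ {x y} → ρ x ≡ ρ y → σ x ≡ σ y → x ≡ y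
  injective {inj₁ _}        {inj₁ _}        refl _    = refl
  injective {inj₁ _}        {inj₂ (inj₁ _)} () _
  injective {inj₁ _}        {inj₂ (inj₂ _)} () _
  injective {inj₂ (inj₁ _)} {inj₂ (inj₁ _)} _    refl = refl
  injective {inj₂ (inj₂ _)} {inj₂ (inj₂ _)} refl _    = refl

  column-leaf : ∀ x {a s} → σ x ≡ inj₂ (inj₁ (a , s)) → ρ x ≡ inj₂ (inj₁ a)
  column-leaf (inj₂ (inj₁ _)) refl = refl

  row-leaf : ∀ x {k s} → ρ x ≡ inj₂ (inj₂ (k , s)) → σ x ≡ inj₂ (inj₂ k)
  row-leaf (inj₂ (inj₂ _)) refl = refl

  opposite≢ : ∀ (s : Fin 2) → opposite s ≢ s
  opposite≢ zero       ()
  opposite≢ (suc zero) ()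

  -- The two leaves of the centre use up both columns, so an edge of `r′` ends in one of them and
  -- its row is the centre itself.
  row-centre-unclosed : ∀ {a r′ l l′} → inj₂ (inj₁ a) ≢ r′ → ¬ Closed (inj₂ (inj₁ a)) r′ l l′
  row-centre-unclosed {a} {r′} {l} {l′} r≢r′ h with x , ρx≡r′ ← ρ-surj r′ =
    r≢r′ (sym (trans (sym ρx≡r′) (leaves (h (leaf zero) .to (inj₁ refl)) (h (leaf (suc zero)) .to (inj₁ refl))
                                         (h x .to (inj₂ ρx≡r′)))))
    where
    open Equivalence
    leaf : Fin 2 → Edge
    leaf s = inj₂ (inj₁ (a , s))
    leaves : σ (leaf zero) ≡ l ⊎ σ (leaf zero) ≡ l′ → σ (leaf (suc zero)) ≡ l ⊎ σ (leaf (suc zero)) ≡ l′ →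
             σ x ≡ l ⊎ σ x ≡ l′ → ρ x ≡ inj₂ (inj₁ a)
    leaves (inj₁ refl) (inj₁ ())
    leaves (inj₂ refl) (inj₂ ())
    leaves (inj₁ refl) (inj₂ refl) (inj₁ eq) = column-leaf x eq
    leaves (inj₁ refl) (inj₂ refl) (inj₂ eq) = column-leaf x eq
    leaves (inj₂ refl) (inj₁ refl) (inj₁ eq) = column-leaf x eq
    leaves (inj₂ refl) (inj₁ refl) (inj₂ eq) = column-leaf x eq

  -- The other leaf of the column `k` must be `r′`. Both rows are then leaves of `k`, so no edge is
  -- left for `l′`.
  leaf-centre-unclosed : ∀ {k s r′ l′} → inj₂ (inj₂ k) ≢ l′ → ¬ Closed (inj₂ (inj₂ (k , s))) r′ (inj₂ (inj₂ k)) l′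
  leaf-centre-unclosed {k} {s} {r′} {l′} l≢l′ h
    with h (inj₂ (inj₂ (k , opposite s))) .Equivalence.from (inj₁ refl)
  ... | inj₁ eq = opposite≢ s (cong proj₂ (inj₂-injective (inj₂-injective eq)))
  ... | inj₂ refl with x , σx≡l′ ← σ-surj l′ with h x .Equivalence.from (inj₂ σx≡l′)
  ...   | inj₁ eq = l≢l′ (trans (sym (row-leaf x eq)) σx≡l′)
  ...   | inj₂ eq = l≢l′ (trans (sym (row-leaf x eq)) σx≡l′)

  row-leaf-unclosed : ∀ {k s r′ l l′} → l ≢ l′ → ¬ Closed (inj₂ (inj₂ (k , s))) r′ l l′
  row-leaf-unclosed {k} {s} l≢l′ h with h (inj₂ (inj₂ (k , s))) .Equivalence.to (inj₁ refl)
  ... | inj₁ refl = leaf-centre-unclosed l≢l′ h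
  ... | inj₂ refl = leaf-centre-unclosed (≢-sym l≢l′) (Closed-swapₗ h)

  unclosed : κ ≤ 1 → ∀ {r r′ l l′} → r ≢ r′ → l ≢ l′ → ¬ Closed r r′ l l′
  unclosed κ≤1 {inj₂ (inj₁ _)} r≢r′ l≢l′ h = row-centre-unclosed r≢r′ h
  unclosed κ≤1 {inj₂ (inj₂ _)} r≢r′ l≢l′ h = row-leaf-unclosed l≢l′ h
  unclosed κ≤1 {r′ = inj₂ (inj₁ _)} r≢r′ l≢l′ h = row-centre-unclosed (≢-sym r≢r′) (Closed-swapᵣ h)
  unclosed κ≤1 {r′ = inj₂ (inj₂ _)} r≢r′ l≢l′ h = row-leaf-unclosed l≢l′ (Closed-swapᵣ h)
  -- Only rows of isolated edges remain, and there is at most one of these.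
  unclosed (s≤s z≤n) {inj₁ zero} {inj₁ zero} r≢r′ l≢l′ h = r≢r′ refl

  another-centre : ∀ {a b : Fin p} → a ≢ b → ∀ (r : Row) → ∃[ c ] inj₂ (inj₁ c) ≢ r
  another-centre {a} a≢b (inj₁ _)        = a , λ ()
  another-centre {a} a≢b (inj₂ (inj₂ _)) = a , λ ()
  another-centre {a} {b} a≢b (inj₂ (inj₁ c)) with a Fin.≟ c
  ... | yes refl = b , λ { refl → a≢b refl }
  ... | no  a≢c  = a , λ { refl → a≢c refl }

  -- Of two row centres one differs from `r`, and of its two leaves one differs from `l`.
  avoid : ∀ {a b : Fin p} → a ≢ b → ∀ r l → ∃[ x ] ρ x ≢ r × σ x ≢ l
  avoid a≢b r l with c , c≢r ← another-centre a≢b r = avoid-leaf l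
    where
    avoid-leaf : ∀ l → ∃[ x ] ρ x ≢ r × σ x ≢ l
    avoid-leaf (inj₁ _)              = inj₂ (inj₁ (c , zero)) , c≢r , λ ()
    avoid-leaf (inj₂ (inj₂ _))       = inj₂ (inj₁ (c , zero)) , c≢r , λ ()
    avoid-leaf (inj₂ (inj₁ (_ , s))) = inj₂ (inj₁ (c , opposite s)) , c≢r ,
      λ eq → opposite≢ s (cong proj₂ (inj₁-injective (inj₂-injective eq)))

  witness : κ ≤ 1 → 2 ≤ p → IncidenceWitness Row Column Edge ρ σ
  witness κ≤1 (s≤s (s≤s _)) = record
    { injective = injective
    ; ρ-surj    = ρ-surj
    ; σ-surj    = σ-surj
    ; avoid     = avoid {zero} {suc zero} λ ()
    ; unclosed  = unclosed κ≤1
    }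

  starCode : κ ≤ 1 → 2 ≤ p → ∃[ C ] Unique C × IsIDCode (K (κ + (p + q * 2)) ×ᴳ K (κ + (p * 2 + q))) C ×
                                    length C ≡ κ + (p * 2 + q * 2)
  starCode κ≤1 2≤p = idCode
    ((↔-id (Fin κ) ⊎-↔ ((↔-id (Fin p) ⊎-↔ *↔×) ↔-∘ +↔⊎)) ↔-∘ +↔⊎)
    ((↔-id (Fin κ) ⊎-↔ ((*↔× ⊎-↔ ↔-id (Fin q)) ↔-∘ +↔⊎)) ↔-∘ +↔⊎)
    ((↔-id (Fin κ) ⊎-↔ ((*↔× ⊎-↔ *↔×) ↔-∘ +↔⊎)) ↔-∘ +↔⊎)
    (witness κ≤1 2≤p)

-- The two bounds for the direct product.

lower : ∀ {n m} → 6 ≤ n → n ≤ m → m ≤ 2 * n ∸ 1 →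
        ∀ C → IsIDCode (K n ×ᴳ K m) C → (2 * m + 2 * n) / 3 ≤ length C
lower {n} {m} 6≤n n≤m m≤2n-1 C idC = ≤-trans (s≤s⁻¹ (m<n*o⇒m/o<n (begin-strict
  2 * m + 2 * n                       ≡⟨ total n m ⟩
  2 * (n + m)                         ≤⟨ lower-bound (codeEdges C) (separating idC) n<2m m<2n (+-mono-≤ 6≤n (≤-trans 6≤n n≤m)) ⟩
  3 * size (codeEdges C) + 2          <⟨ n<1+n _ ⟩
  suc (3 * size (codeEdges C) + 2)    ≡⟨ regroup (size (codeEdges C)) ⟩
  suc (size (codeEdges C)) * 3        ∎))) (size≤length C)
  where
  open ≤-Reasoning
  total : ∀ n m → 2 * m + 2 * n ≡ 2 * (n + m)
  total = solve-∀
  regroup : ∀ e → 1 + (3 * e + 2) ≡ (1 + e) * 3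
  regroup = solve-∀
  0<n : 0 < n
  0<n = ≤-trans (s≤s z≤n) 6≤n
  n<2m : n < 2 * m
  n<2m = ≤-<-trans n≤m (m<m+n m (subst (0 <_) (sym (+-identityʳ m)) (≤-trans 0<n n≤m)))
  m<2n : m < 2 * n
  -- Subtraction is truncated, so `2 * n ∸ 1 < 2 * n` rests on `0 < n`.
  m<2n = ≤-<-trans m≤2n-1 (∸-monoʳ-< {o = 0} (s≤s z≤n) (≤-trans 0<n (m≤m+n n _)))

-- The numbers p and q of components P₃ centred in rows and in columns solve
-- n = κ + p + 2 q and m = κ + 2 p + q; hence κ + 3 q = 2 n − m.
upper : ∀ {n m} → 6 ≤ n → n ≤ m → m ≤ 2 * n ∸ 1 → ((n + m) % 3 ≡ 0 ⊎ (n + m) % 3 ≡ 2) →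
        ∃[ C ] Unique C × IsIDCode (K n ×ᴳ K m) C × length C ≡ (2 * m + 2 * n) / 3
upper {n} {m} 6≤n n≤m m≤2n-1 mod =
  subst₂ (λ n m → ∃[ C ] Unique C × IsIDCode (K n ×ᴳ K m) C × length C ≡ (2 * m + 2 * n) / 3) (sym n≡) (sym m≡)
    (subst (λ e → ∃[ C ] Unique C × IsIDCode (K (κ + (p + q * 2)) ×ᴳ K (κ + (p * 2 + q))) C × length C ≡ e)
      (sym size≡) (StarForest.starCode κ p q κ≤1 2≤p))
  where
  a d κ p q : ℕ
  a = 2 * n ∸ m
  d = m ∸ n
  κ = a % 3
  q = a / 3
  -- The difference of the two equations is `m − n = p − q`.
  p = d + q
  a≡ : a ≡ κ + q * 3
  a≡ = m≡m%n+[m/n]*n a 3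
  n+d≡m : n + d ≡ m
  n+d≡m = m+[n∸m]≡n n≤m
  d+a≡n : d + a ≡ n
  d+a≡n = +-cancelˡ-≡ n (d + a) n (begin-equality
    n + (d + a) ≡⟨ +-assoc n d a ⟨
    n + d + a   ≡⟨ cong (_+ a) n+d≡m ⟩
    m + a       ≡⟨ m+[n∸m]≡n (≤-trans m≤2n-1 (m∸n≤m (2 * n) 1)) ⟩
    2 * n       ≡⟨ cong (n +_) (+-identityʳ n) ⟩
    n + n       ∎)
    where open ≤-Reasoning
  n≡ : n ≡ κ + (p + q * 2)
  n≡ = trans (sym d+a≡n) (trans (cong (d +_) a≡) (lemma d κ q))
    where lemma : ∀ d κ q → d + (κ + q * 3) ≡ κ + ((d + q) + q * 2)
          lemma = solve-∀
  m≡ : m ≡ κ + (p * 2 + q)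
  m≡ = trans (sym n+d≡m) (trans (cong (_+ d) n≡) (lemma d κ q))
    where lemma : ∀ d κ q → κ + ((d + q) + q * 2) + d ≡ κ + ((d + q) * 2 + q)
          lemma = solve-∀
  residue : (n + m) % 3 ≡ (κ * 2) % 3
  residue = trans (cong (_% 3) (trans (cong₂ _+_ n≡ m≡) (lemma κ p q))) ([m+kn]%n≡m%n (κ * 2) (p + q) 3)
    where lemma : ∀ κ p q → κ + (p + q * 2) + (κ + (p * 2 + q)) ≡ κ * 2 + (p + q) * 3
          lemma = solve-∀
  -- Since `n + m ≡ 2 κ` modulo 3, `κ = 2` would give the excluded residue 1.
  κ≤1 : κ ≤ 1
  κ≤1 = small κ (m%n<n a 3) (Sum.map (trans (sym residue)) (trans (sym residue)) mod)
    where small : ∀ κ → κ < 3 → (κ * 2) % 3 ≡ 0 ⊎ (κ * 2) % 3 ≡ 2 → κ ≤ 1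
          small 0 _ _ = z≤n
          small 1 _ _ = ≤-refl
          small 2 _ (inj₁ ())
          small 2 _ (inj₂ ())
          small (suc (suc (suc _))) (s≤s (s≤s (s≤s ()))) _
  -- As `q ≤ p`, having `p ≤ 1` would force `n ≤ 1 + 1 + 2 = 4`.
  2≤p : 2 ≤ p
  2≤p = ≰⇒> λ p≤1 → <⇒≱ (s≤s (s≤s (s≤s (s≤s (s≤s z≤n))))) (≤-trans 6≤n (≤-trans (≤-reflexive n≡)
    (+-mono-≤ κ≤1 (+-mono-≤ p≤1 (*-monoˡ-≤ 2 (≤-trans (m≤n+m q d) p≤1))))))
  -- Twice the number of lines is `κ` plus three times the number of edges, and `κ < 3` vanishes in
  -- the quotient.
  size≡ : (2 * (κ + (p * 2 + q)) + 2 * (κ + (p + q * 2))) / 3 ≡ κ + (p * 2 + q * 2)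
  size≡ = trans (cong (_/ 3) (lemma κ p q))
    (trans (+-distrib-/-∣ʳ κ (divides-refl (κ + (p * 2 + q * 2))))
      (cong₂ _+_ (m<n⇒m/n≡0 (m%n<n a 3)) (m*n/n≡m (κ + (p * 2 + q * 2)) 3)))
    where lemma : ∀ κ p q → 2 * (κ + (p * 2 + q)) + 2 * (κ + (p + q * 2)) ≡ κ + (κ + (p * 2 + q * 2)) * 3
          lemma = solve-∀

theorem3 : (n m : ℕ) → 6 ≤ n → n ≤ m → m ≤ 2 * n ∸ 1 →
    ((n + m) % 3 ≡ 0 ⊎ (n + m) % 3 ≡ 2) →
    IsγID (K n ×ᴳ K m) ((2 * m + 2 * n) / 3)
theorem3 n m 6≤n n≤m m≤2n-1 mod = upper 6≤n n≤m m≤2n-1 mod , λ C _ → lower 6≤n n≤m m≤2n-1 C
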